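{- Let $p$ be a prime. Then $$\sum_{k=0}^{p-1}T_k^{(2)}\equiv \frac{p^2}{2}\left(5-3\left(\frac{p}{5}\right)\right)\pmod{p^3},$$ where $T_m^{(2)}=\sum_{k=0}^{m}\binom{m}{k}^2\binom{2k}{k}(2k+1)^{2}(-1)^k$ and $\left(\frac{p}{5}\right)$ is the Legendre symbol modulo $5$.
   Context: The congruence between rational numbers is understood in the ring of rationals whose denominators are prime to $p$ (when the right-hand side is not an integer). -}

module Defs where

open import Data.Nat as ℕ using (ℕ; zero; suc; _%_)
open import Data.Nat.Combinatorics using (_C_)
open import Data.Nat.Divisibility using (_∣_)
open import Data.Integer as ℤ using (ℤ; +_; -_)
open import Data.Rational as ℚ using (ℚ; _/_)
open import Data.Product using (Σ; _×_)
open import Relation.Nullary using (¬_)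
open import Relation.Binary.PropositionalEquality using (_≡_)

sumTo : ℕ → (ℕ → ℤ) → ℤ
sumTo zero    f = f 0
sumTo (suc n) f = sumTo n f ℤ.+ f (suc n)

negOnePow : ℕ → ℤ
negOnePow zero    = + 1
negOnePow (suc k) = - negOnePow k

T2 : ℕ → ℤ
T2 m = sumTo m (λ k →
  + ((m C k) ℕ.^ 2 ℕ.* ((2 ℕ.* k) C k) ℕ.* (2 ℕ.* k ℕ.+ 1) ℕ.^ 2) ℤ.* negOnePow k)

sumT2 : ℕ → ℤ
sumT2 zero    = + 0
sumT2 (suc n) = sumTo n T2

legendre5 : ℕ → ℤ
legendre5 p with p % 5
... | 0 = + 0
... | 1 = + 1
... | 4 = + 1
... | _ = - (+ 1)

-- x ≡ y (mod p^e) in the ring Z_(p) of rationals with denominator prime to p: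
-- x - y = p^e * (a / b) with p ∤ b.
CongModPPow : ℕ → ℕ → ℚ → ℚ → Set
CongModPPow p e x y =
  Σ ℤ λ a → Σ ℕ λ b → (¬ (p ∣ b)) ×
    ((x ℚ.- y) ℚ.* (+ b / 1) ≡ (+ (p ℕ.^ e) / 1) ℚ.* (a / 1))

{-# OPTIONS --safe #-}

-- Write c k = (-1)^k C(2k,k).  The summand of T2 has an antidifference in m
-- (found by creative telescoping), which gives
--   2 Σ_{m<n} T2 m = Σ_{k≤n} (2nk - 3k²) C(n,k)² c k.
-- Since k C(p,k) = p C(p-1,k-1), at n = p the right-hand side is p² times a sum
-- that only matters mod p; as C(p-1,j)² ≡ 1, C(p,j) ≡ 0 and C(2p,p) ≡ 2, for odd p
-- that sum is 5 - 3 Σ_{k<p} c k.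
-- It remains to see that Σ_{k<p} c k ≡ F_{2p} ≡ (p/5) mod p.  The first congruence
-- comes from the exact formula
--   Σ_{k<n} c k = (-1)^n Σ_{d≤n} C(2n,n+d) (-1)^d F_{2d},
-- where only d = p survives.  For the second, let E be the shift: (1+E)² acts on the
-- Legendre symbol mod 5 with eigenvalues those of the recurrence of F_{2n},
-- while (1+E)^p ≡ 1 + E^p.

module Submission where

open import Defs
open import Data.Nat as ℕ using (ℕ; zero; suc; z≤n; s≤s)
open import Data.Nat.Combinatorics
  using (_C_; nCk+nC[k+1]≡[n+1]C[k+1]; k>n⇒nCk≡0; nCn≡1; nC1≡n; nCk≡nC[n∸k])
open import Data.Nat.Divisibility using (_∣_; divides; ∣⇒≤)
open import Data.Nat.Primality using (Prime; euclidsLemma; prime⇒irreducible; ¬prime[1])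
import Data.Nat.Properties as ℕₚ
open import Data.Integer as ℤ using (ℤ; +_; -_; _+_; _*_; _-_)
import Data.Integer.Properties as ℤₚ
open import Data.Integer.Tactic.RingSolver using (solve-∀)
open import Data.Product using (∃; _,_; proj₁; proj₂)
open import Data.Rational as ℚ using (_/_; toℚᵘ)
import Data.Rational.Properties as ℚₚ
open import Data.Rational.Unnormalised as ℚᵘ using (mkℚᵘ; *≡*)
import Data.Rational.Unnormalised.Properties as ℚᵘₚ
open import Data.Sum using (_⊎_; inj₁; inj₂)
open import Relation.Nullary using (contradiction)
open import Relation.Binary.PropositionalEquality
  using (_≡_; refl; sym; trans; cong; cong₂; module ≡-Reasoning)

open ≡-Reasoning

-- Finite sums and binomial identities over the integers.

-- Proves l ≡ r modulo the ideal generated by x - y; the last argument is a ring identity.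
by-relation : ∀ {l r x y} q → x ≡ y → l ≡ r + q * (x - y) → l ≡ r
by-relation {l} {r} {x} q refl l≡ = trans l≡ (cancel r q x)
  where
  cancel : ∀ r q x → r + q * (x - x) ≡ r
  cancel = solve-∀

sumTo-cong : ∀ n {f g : ℕ → ℤ} → (∀ k → f k ≡ g k) → sumTo n f ≡ sumTo n g
sumTo-cong zero    f≡g = f≡g 0
sumTo-cong (suc n) f≡g = cong₂ _+_ (sumTo-cong n f≡g) (f≡g (suc n))

sumTo-head : ∀ n (f : ℕ → ℤ) → sumTo (suc n) f ≡ f 0 + sumTo n (λ k → f (suc k))
sumTo-head zero    f = refl
sumTo-head (suc n) f =
  trans (cong (_+ f (suc (suc n))) (sumTo-head n f)) (ℤₚ.+-assoc (f 0) _ _)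

sumTo-*ˡ : ∀ n a (f : ℕ → ℤ) → sumTo n (λ k → a * f k) ≡ a * sumTo n f
sumTo-*ˡ zero    a f = refl
sumTo-*ˡ (suc n) a f =
  trans (cong (_+ a * f (suc n)) (sumTo-*ˡ n a f)) (sym (ℤₚ.*-distribˡ-+ a _ _))

binom : ℕ → ℕ → ℤ
binom n k = + (n C k)

binom-pascal : ∀ n k → binom (suc n) (suc k) ≡ binom n k + binom n (suc k)
binom-pascal n k = cong +_ (sym (nCk+nC[k+1]≡[n+1]C[k+1] n k))

binom-> : ∀ {n k} → n ℕ.< k → binom n k ≡ + 0
binom-> n<k = cong +_ (k>n⇒nCk≡0 n<k)

-- Induction by Pascal's rule on both sides, without factorials, so that no bound `k ≤ n` has to be
-- carried along.
binom-absorption : ∀ n k → + suc k * binom (suc n) (suc k) ≡ + suc n * binom n k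
binom-absorption n zero =
  trans (cong (λ t → + 1 * + t) (nC1≡n (suc n))) (ℤₚ.*-comm (+ 1) (+ suc n))
binom-absorption zero (suc k) = begin
  + suc (suc k) * binom 1 (suc (suc k)) ≡⟨ cong (+ suc (suc k) *_) (binom-> {1} {suc (suc k)} (s≤s (s≤s z≤n))) ⟩
  + suc (suc k) * + 0                   ≡⟨ ℤₚ.*-zeroʳ (+ suc (suc k)) ⟩
  + 0                                   ≡⟨ cong (+ 1 *_) (binom-> {0} {suc k} (s≤s z≤n)) ⟨
  + 1 * binom 0 (suc k)                 ∎
binom-absorption (suc n) (suc k) =
  by-relation (+ 1) (binom-absorption n k)
    (by-relation (+ 1) (binom-absorption n (suc k))
      (by-relation (- + suc n) (binom-pascal n k)
        (by-relation (+ suc (suc k)) (binom-pascal (suc n) (suc k))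
          (ring (+ suc k) (+ suc n) (binom n k) (binom n (suc k)) (binom (suc n) (suc k))
            (binom (suc n) (suc (suc k))) (binom (suc (suc n)) (suc (suc k)))))))
  where
  ring : ∀ k n a b d e g →
    (+ 1 + k) * g ≡ (((+ 1 + n) * d + + 1 * (k * d - n * a))
      + + 1 * ((+ 1 + k) * e - n * b)) + (- n) * (d - (a + b))
      + (+ 1 + k) * (g - (d + e))
  ring = solve-∀

2*n≡n+n : ∀ n → 2 ℕ.* n ≡ n ℕ.+ n
2*n≡n+n n = cong (n ℕ.+_) (ℕₚ.+-identityʳ n)

-- Pascal's rule and the symmetry of row 2k+1 give C(2k+2,k+1) = 2 C(2k+1,k+1), and absorption
-- evaluates (k+1) C(2k+1,k+1).
binom-central : ∀ k → + suc k * binom (2 ℕ.* suc k) (suc k) ≡ + 2 * (+ 2 * + k + + 1) * binom (2 ℕ.* k) k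
binom-central k = begin
  + suc k * binom (2 ℕ.* suc k) (suc k)
    ≡⟨ cong (λ N → + suc k * binom N (suc k))
         (trans (2*n≡n+n (suc k)) (cong suc (ℕₚ.+-suc k k))) ⟩
  + suc k * binom (suc (suc (k ℕ.+ k))) (suc k)
    ≡⟨ cong (+ suc k *_) (binom-pascal (suc (k ℕ.+ k)) k) ⟩
  + suc k * (binom (suc (k ℕ.+ k)) k + binom (suc (k ℕ.+ k)) (suc k))
    ≡⟨ cong (λ t → + suc k * (t + binom (suc (k ℕ.+ k)) (suc k))) symmetric ⟩
  + suc k * (binom (suc (k ℕ.+ k)) (suc k) + binom (suc (k ℕ.+ k)) (suc k))
    ≡⟨ by-relation (+ 2) (binom-absorption (k ℕ.+ k) k) (ring (+ k) (binom (suc (k ℕ.+ k)) (suc k)) (binom (k ℕ.+ k) k)) ⟩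
  + 2 * (+ 2 * + k + + 1) * binom (k ℕ.+ k) k
    ≡⟨ cong (λ N → + 2 * (+ 2 * + k + + 1) * binom N k) (2*n≡n+n k) ⟨
  + 2 * (+ 2 * + k + + 1) * binom (2 ℕ.* k) k ∎
  where
  symmetric : binom (suc (k ℕ.+ k)) k ≡ binom (suc (k ℕ.+ k)) (suc k)
  symmetric = cong +_ (trans (nCk≡nC[n∸k] (ℕₚ.m≤n⇒m≤1+n (ℕₚ.m≤m+n k k)))
    (cong (suc (k ℕ.+ k) C_) (ℕₚ.m+n∸n≡m (suc k) k)))
  ring : ∀ k x y → (+ 1 + k) * (x + x) ≡
    + 2 * (+ 2 * k + + 1) * y + + 2 * ((+ 1 + k) * x - (+ 1 + (k + k)) * y)
  ring = solve-∀

-- Creative telescoping for the sums of `T2`.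

signedCentral : ℕ → ℤ
signedCentral k = binom (2 ℕ.* k) k * negOnePow k

signedCentral-suc : ∀ k → + suc k * signedCentral (suc k) ≡ - (+ 2 * (+ 2 * + k + + 1)) * signedCentral k
signedCentral-suc k = by-relation (- negOnePow k) (binom-central k) (ring (+ k) (negOnePow k) (binom (2 ℕ.* suc k) (suc k)) (binom (2 ℕ.* k) k))
  where
  ring : ∀ k s x y → (+ 1 + k) * (x * - s) ≡ - (+ 2 * (+ 2 * k + + 1)) * (y * s)
    + (- s) * ((+ 1 + k) * x - + 2 * (+ 2 * k + + 1) * y)
  ring = solve-∀

T2-term : ℕ → ℕ → ℤ
T2-term m k = (+ 2 * + k + + 1) * (+ 2 * + k + + 1) * (binom m k * binom m k) * signedCentral k

pos-^2 : ∀ n → + (n ℕ.^ 2) ≡ + n * + n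
pos-^2 n = trans (cong (λ t → + (n ℕ.* t)) (ℕₚ.*-identityʳ n)) (ℤₚ.pos-* n n)

T2≡sum : ∀ m → T2 m ≡ sumTo m (T2-term m)
T2≡sum m = sumTo-cong m (λ k → trans
  (cong (_* negOnePow k) (cast (m C k) ((2 ℕ.* k) C k) k))
  (ring (+ k) (negOnePow k) (binom m k) (binom (2 ℕ.* k) k)))
  where
  odd : ∀ k → + (2 ℕ.* k ℕ.+ 1) ≡ + 2 * + k + + 1
  odd k = cong (_+ + 1) (ℤₚ.pos-* 2 k)
  cast : ∀ a b k → + (a ℕ.^ 2 ℕ.* b ℕ.* (2 ℕ.* k ℕ.+ 1) ℕ.^ 2)
    ≡ + a * + a * + b * ((+ 2 * + k + + 1) * (+ 2 * + k + + 1))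
  cast a b k = trans (ℤₚ.pos-* (a ℕ.^ 2 ℕ.* b) _)
    (cong₂ _*_ (trans (ℤₚ.pos-* (a ℕ.^ 2) b) (cong (_* + b) (pos-^2 a)))
      (trans (pos-^2 (2 ℕ.* k ℕ.+ 1)) (cong₂ _*_ (odd k) (odd k))))
  ring : ∀ k s a b → a * a * b * ((+ 2 * k + + 1) * (+ 2 * k + + 1)) * s
    ≡ (+ 2 * k + + 1) * (+ 2 * k + + 1) * (a * a) * (b * s)
  ring = solve-∀

-- Antidifference in n of the summand of 2 T2, up to a difference in k.
antidifference : ℕ → ℕ → ℤ
antidifference n k =
  (+ 2 * + n * + k - + 3 * + k * + k) * (binom n k * binom n k) * signedCentral k

-- The right-hand side is the telescoping certificate; by `signedCentral-suc` it equals (K+1)²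
-- C(m,K)² c (K+1). Induction on K checks that its difference in K is the summand on the left.
antidifference-partial : ∀ m K →
  sumTo K (antidifference (suc m)) - sumTo K (antidifference m) - + 2 * sumTo K (T2-term m)
  ≡ - (+ 2 * + suc K * (+ 2 * + K + + 1)) * (binom m K * binom m K) * signedCentral K
antidifference-partial m zero = ring (+ m)
  where
  ring : ∀ m → (+ 2 * (+ 1 + m) * + 0 - + 0) * + 1 * + 1 - (+ 2 * m * + 0 - + 0) * + 1 * + 1 - + 2 ≡ - + 2
  ring = solve-∀
antidifference-partial m (suc j) =
  step (+ m) (+ j) (binom m (suc j)) (binom m j) (binom (suc m) (suc j))
    (signedCentral j) (signedCentral (suc j))
    (sumTo j (antidifference (suc m))) (sumTo j (antidifference m)) (sumTo j (T2-term m))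
    (binom-pascal m j) (binom-absorption m j) (signedCentral-suc j) (antidifference-partial m j)
  where
  -- A, B, D stand for C(m,j+1), C(m,j), C(m+1,j+1), and c, e for `signedCentral` at j and j+1. The
  -- last four summands are multiples of the induction hypothesis, the recurrence of c, absorption
  -- and Pascal's rule.
  ring : ∀ m j A B D c e S₁ S₂ S₃ → let k = + 1 + j; n = + 1 + m in
    (S₁ + (+ 2 * n * k - + 3 * k * k) * (D * D) * e)
      - (S₂ + (+ 2 * m * k - + 3 * k * k) * (A * A) * e)
      - + 2 * (S₃ + (+ 2 * k + + 1) * (+ 2 * k + + 1) * (A * A) * e)
    ≡ - (+ 2 * (+ 1 + k) * (+ 2 * k + + 1)) * (A * A) * e
      + + 1 * ((S₁ - S₂ - + 2 * S₃) - (- (+ 2 * k * (+ 2 * j + + 1)) * (B * B) * c))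
      + (- (k * B * B)) * (k * e - (- (+ 2 * (+ 2 * j + + 1)) * c))
      + (- (+ 2 * k * (+ 2 * A + B) * e)) * (k * D - n * B)
      + ((+ 2 * n * k - + 3 * k * k) * (D + A + B) * e
        + + 2 * k * (+ 2 * A + B) * e * k) * (D - (B + A))
  ring = solve-∀
  step : ∀ m j A B D c e S₁ S₂ S₃ → let k = + 1 + j; n = + 1 + m in
    D ≡ B + A →
    k * D ≡ n * B →
    k * e ≡ - (+ 2 * (+ 2 * j + + 1)) * c →
    S₁ - S₂ - + 2 * S₃ ≡ - (+ 2 * k * (+ 2 * j + + 1)) * (B * B) * c →
    (S₁ + (+ 2 * n * k - + 3 * k * k) * (D * D) * e)
      - (S₂ + (+ 2 * m * k - + 3 * k * k) * (A * A) * e)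
      - + 2 * (S₃ + (+ 2 * k + + 1) * (+ 2 * k + + 1) * (A * A) * e)
    ≡ - (+ 2 * (+ 1 + k) * (+ 2 * k + + 1)) * (A * A) * e
  step m j A B D c e S₁ S₂ S₃ pascal absorb central IH =
    by-relation (+ 1) IH
    (by-relation (- (k * B * B)) central
    (by-relation (- (+ 2 * k * (+ 2 * A + B) * e)) absorb
    (by-relation ((+ 2 * n * k - + 3 * k * k) * (D + A + B) * e
        + + 2 * k * (+ 2 * A + B) * e * k) pascal
    (ring m j A B D c e S₁ S₂ S₃))))
    where
    k n : ℤ
    k = + 1 + j
    n = + 1 + m

-- At K = m+1 the factor C(m,m+1) = 0 kills the certificate and the top terms of both sums over row
-- m.
antidifference-step : ∀ m →
  sumTo (suc m) (antidifference (suc m)) ≡ sumTo m (antidifference m) + + 2 * T2 m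
antidifference-step m =
  trans (step (+ m) (binom m (suc m)) (signedCentral (suc m))
    (sumTo (suc m) (antidifference (suc m))) (sumTo m (antidifference m)) (sumTo m (T2-term m))
    (binom-> {m} {suc m} ℕₚ.≤-refl) (antidifference-partial m (suc m)))
  (cong (λ t → sumTo m (antidifference m) + + 2 * t) (sym (T2≡sum m)))
  where
  step : ∀ m b c S₁ S₂ S₃ → let k = + 1 + m in b ≡ + 0 →
    S₁ - (S₂ + (+ 2 * m * k - + 3 * k * k) * (b * b) * c)
      - + 2 * (S₃ + (+ 2 * k + + 1) * (+ 2 * k + + 1) * (b * b) * c)
      ≡ - (+ 2 * (+ 1 + k) * (+ 2 * k + + 1)) * (b * b) * c →
    S₁ ≡ S₂ + + 2 * S₃
  step m _ c S₁ S₂ S₃ refl h = by-relation (+ 1) h (ring m c S₁ S₂ S₃)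
    where
    ring : ∀ m c S₁ S₂ S₃ → let k = + 1 + m in
      S₁ ≡ S₂ + + 2 * S₃ + + 1 * ((S₁ - (S₂ + (+ 2 * m * k - + 3 * k * k) * + 0 * c)
        - + 2 * (S₃ + (+ 2 * k + + 1) * (+ 2 * k + + 1) * + 0 * c))
        - - (+ 2 * (+ 1 + k) * (+ 2 * k + + 1)) * + 0 * c)
    ring = solve-∀

2*sumT2 : ∀ n → + 2 * sumTo n T2 ≡ sumTo (suc n) (antidifference (suc n))
2*sumT2 zero = refl
2*sumT2 (suc n) = begin
  + 2 * (sumTo n T2 + T2 (suc n))       ≡⟨ ℤₚ.*-distribˡ-+ (+ 2) (sumTo n T2) (T2 (suc n)) ⟩
  + 2 * sumTo n T2 + + 2 * T2 (suc n)   ≡⟨ cong (_+ + 2 * T2 (suc n)) (2*sumT2 n) ⟩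
  sumTo (suc n) (antidifference (suc n)) + + 2 * T2 (suc n) ≡⟨ antidifference-step (suc n) ⟨
  sumTo (suc (suc n)) (antidifference (suc (suc n))) ∎

-- antidifference (suc q) (suc j), divided by (suc q)².
reducedTerm : ℕ → ℕ → ℤ
reducedTerm q j = (+ 2 * (binom q j * binom (suc q) (suc j)) - + 3 * (binom q j * binom q j))
  * signedCentral (suc j)

-- With n = q+1, absorption turns n k C(n,k)² into n² C(n-1,k-1) C(n,k), and k² C(n,k)² into n²
-- C(n-1,k-1)². The term k = 0 is zero, so the sum is reindexed by k = j+1.
2*sumT2-factor : ∀ q → + 2 * sumTo q T2 ≡ + suc q * + suc q * sumTo q (reducedTerm q)
2*sumT2-factor q = begin
  + 2 * sumTo q T2                                            ≡⟨ 2*sumT2 q ⟩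
  sumTo (suc q) (antidifference (suc q))                      ≡⟨ sumTo-head q (antidifference (suc q)) ⟩
  antidifference (suc q) 0 + sumTo q (λ j → antidifference (suc q) (suc j))
    ≡⟨ cong₂ _+_ (zeroth (+ suc q)) (sumTo-cong q (λ j →
         step (+ suc q) (+ suc j) (binom q j) (binom (suc q) (suc j)) (signedCentral (suc j))
           (binom-absorption q j))) ⟩
  + 0 + sumTo q (λ j → + suc q * + suc q * reducedTerm q j)   ≡⟨ ℤₚ.+-identityˡ _ ⟩
  sumTo q (λ j → + suc q * + suc q * reducedTerm q j)         ≡⟨ sumTo-*ˡ q (+ suc q * + suc q) (reducedTerm q) ⟩
  + suc q * + suc q * sumTo q (reducedTerm q)                 ∎
  where
  zeroth : ∀ n → (+ 2 * n * + 0 - + 0) * + 1 * + 1 ≡ + 0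
  zeroth = solve-∀
  ring : ∀ n k B D c → (+ 2 * n * k - + 3 * k * k) * (D * D) * c
    ≡ n * n * ((+ 2 * (B * D) - + 3 * (B * B)) * c)
      + ((+ 2 * n * D - + 3 * (k * D + n * B)) * c) * (k * D - n * B)
  ring = solve-∀
  step : ∀ n k B D c → k * D ≡ n * B →
    (+ 2 * n * k - + 3 * k * k) * (D * D) * c ≡ n * n * ((+ 2 * (B * D) - + 3 * (B * B)) * c)
  step n k B D c h = by-relation ((+ 2 * n * D - + 3 * (k * D + n * B)) * c) h (ring n k B D c)

-- Powers of the operator 1 + E, where E is the shift.

pairSum : (ℕ → ℤ) → ℕ → ℤ
pairSum f j = f j + f (suc j)

pairSum^ : ℕ → (ℕ → ℤ) → ℕ → ℤ
pairSum^ zero    f = f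
pairSum^ (suc n) f = pairSum^ n (pairSum f)

-- The definition applies the additional factor 1 + E first; here it is applied last.
pairSum^-suc : ∀ n f j → pairSum^ (suc n) f j ≡ pairSum^ n f j + pairSum^ n f (suc j)
pairSum^-suc zero    f j = refl
pairSum^-suc (suc n) f j = pairSum^-suc n (pairSum f) j

pairSum^-+ : ∀ m n f → pairSum^ (m ℕ.+ n) f ≡ pairSum^ n (pairSum^ m f)
pairSum^-+ zero    n f = refl
pairSum^-+ (suc m) n f = pairSum^-+ m n (pairSum f)

-- The free cutoff K lets the induction run; its boundary term vanishes at K = n.
sumTo-pascal : ∀ n K (g : ℕ → ℤ) →
  sumTo (suc K) (λ k → binom (suc n) k * g k)
  ≡ sumTo K (λ k → binom n k * (g k + g (suc k))) + binom n (suc K) * g (suc K)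
sumTo-pascal n zero g = begin
  + 1 * g 0 + binom (suc n) 1 * g 1        ≡⟨ cong (λ t → + 1 * g 0 + t * g 1) (binom-pascal n 0) ⟩
  + 1 * g 0 + (+ 1 + binom n 1) * g 1      ≡⟨ ring (g 0) (g 1) (binom n 1) ⟩
  + 1 * (g 0 + g 1) + binom n 1 * g 1      ∎
  where
  ring : ∀ a b c → + 1 * a + (+ 1 + c) * b ≡ + 1 * (a + b) + c * b
  ring = solve-∀
sumTo-pascal n (suc K) g = begin
  sumTo (suc K) (λ k → binom (suc n) k * g k) + binom (suc n) (suc (suc K)) * g (suc (suc K))
    ≡⟨ cong₂ (λ s t → s + t * g (suc (suc K))) (sumTo-pascal n K g) (binom-pascal n (suc K)) ⟩
  S + binom n (suc K) * g (suc K) + (binom n (suc K) + binom n (suc (suc K))) * g (suc (suc K))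
    ≡⟨ ring S (g (suc K)) (g (suc (suc K))) (binom n (suc K)) (binom n (suc (suc K))) ⟩
  S + binom n (suc K) * (g (suc K) + g (suc (suc K))) + binom n (suc (suc K)) * g (suc (suc K)) ∎
  where
  S = sumTo K (λ k → binom n k * (g k + g (suc k)))
  ring : ∀ S a b c d → S + c * a + (c + d) * b ≡ S + c * (a + b) + d * b
  ring = solve-∀

-- The binomial theorem for (1+E)^n.
pairSum^-binomial : ∀ n f j → pairSum^ n f j ≡ sumTo n (λ k → binom n k * f (j ℕ.+ k))
pairSum^-binomial zero f j =
  sym (trans (ℤₚ.*-identityˡ (f (j ℕ.+ 0))) (cong f (ℕₚ.+-identityʳ j)))
pairSum^-binomial (suc n) f j = begin
  pairSum^ n (pairSum f) j
    ≡⟨ pairSum^-binomial n (pairSum f) j ⟩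
  sumTo n (λ k → binom n k * (f (j ℕ.+ k) + f (suc (j ℕ.+ k))))
    ≡⟨ sumTo-cong n (λ k → cong (λ t → binom n k * (f (j ℕ.+ k) + f t)) (ℕₚ.+-suc j k)) ⟨
  S
    ≡⟨ ℤₚ.+-identityʳ S ⟨
  S + + 0
    ≡⟨ cong (λ t → S + t * f (j ℕ.+ suc n)) (binom-> {n} {suc n} ℕₚ.≤-refl) ⟨
  S + binom n (suc n) * f (j ℕ.+ suc n)
    ≡⟨ sumTo-pascal n n (λ k → f (j ℕ.+ k)) ⟨
  sumTo (suc n) (λ k → binom (suc n) k * f (j ℕ.+ k)) ∎
  where
  S = sumTo n (λ k → binom n k * (f (j ℕ.+ k) + f (j ℕ.+ suc k)))

-- By Pascal's rule 1 + E sends a row to the next one, shifted by one place. Together with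
-- `pairSum^-binomial` this is Vandermonde's convolution.
pairSum^-binom : ∀ m n d → pairSum^ m (binom n) d ≡ binom (m ℕ.+ n) (m ℕ.+ d)
pairSum^-binom zero    n d = refl
pairSum^-binom (suc m) n d = begin
  pairSum^ (suc m) (binom n) d                                 ≡⟨ pairSum^-suc m (binom n) d ⟩
  pairSum^ m (binom n) d + pairSum^ m (binom n) (suc d)        ≡⟨ cong₂ _+_ (pairSum^-binom m n d) (pairSum^-binom m n (suc d)) ⟩
  binom (m ℕ.+ n) (m ℕ.+ d) + binom (m ℕ.+ n) (m ℕ.+ suc d)    ≡⟨ cong (λ t → binom (m ℕ.+ n) (m ℕ.+ d) + binom (m ℕ.+ n) t) (ℕₚ.+-suc m d) ⟩
  binom (m ℕ.+ n) (m ℕ.+ d) + binom (m ℕ.+ n) (suc (m ℕ.+ d))  ≡⟨ binom-pascal (m ℕ.+ n) (m ℕ.+ d) ⟨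
  binom (suc m ℕ.+ n) (suc m ℕ.+ d)                            ∎

-- Even-indexed Fibonacci numbers and the Legendre symbol modulo 5.

-- The Fibonacci number F_{2n}.
evenFib : ℕ → ℤ
evenFib 0             = + 0
evenFib 1             = + 1
evenFib (suc (suc n)) = + 3 * evenFib (suc n) - evenFib n

-- Recursion with period 5 reduces identities to a check on five residues.
χ₅ : ℕ → ℤ
χ₅ 0 = + 0
χ₅ 1 = + 1
χ₅ 2 = - + 1
χ₅ 3 = - + 1
χ₅ 4 = + 1
χ₅ (suc (suc (suc (suc (suc n))))) = χ₅ n

-- ν₅ d = χ₅ (d + 1) - χ₅ d + χ₅ (d - 1): together with χ₅ it spans a space stable under (1+E)²E⁻¹.
ν₅ : ℕ → ℤ
ν₅ 0 = + 2
ν₅ 1 = - + 2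
ν₅ 2 = + 1
ν₅ 3 = + 1
ν₅ 4 = - + 2
ν₅ (suc (suc (suc (suc (suc n))))) = ν₅ n

χ₅≡legendre5 : ∀ n → χ₅ n ≡ legendre5 n
χ₅≡legendre5 0 = refl
χ₅≡legendre5 1 = refl
χ₅≡legendre5 2 = refl
χ₅≡legendre5 3 = refl
χ₅≡legendre5 4 = refl
χ₅≡legendre5 (suc (suc (suc (suc (suc n))))) = χ₅≡legendre5 n

-- 4 is a square modulo 5.
χ₅-*4 : ∀ n → χ₅ (n ℕ.* 4) ≡ χ₅ n
χ₅-*4 0 = refl
χ₅-*4 1 = refl
χ₅-*4 2 = refl
χ₅-*4 3 = refl
χ₅-*4 4 = refl
χ₅-*4 (suc (suc (suc (suc (suc n))))) = χ₅-*4 n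

χ₅-*5+ : ∀ n r → χ₅ (n ℕ.* 5 ℕ.+ r) ≡ χ₅ r
χ₅-*5+ zero    r = refl
χ₅-*5+ (suc n) r = χ₅-*5+ n r

ν₅-*5 : ∀ n → ν₅ (n ℕ.* 5) ≡ + 2
ν₅-*5 zero    = refl
ν₅-*5 (suc n) = ν₅-*5 n

-- With `ν₅-second-pairSum`: (1+E)²E⁻¹ sends `χ₅` to 3`χ₅` + `ν₅` and `ν₅` to -`χ₅`. Its
-- characteristic polynomial x² - 3x + 1 is that of the recurrence of `evenFib`.
χ₅-second-pairSum : ∀ n → pairSum (pairSum χ₅) n ≡ ν₅ (suc n) + + 3 * χ₅ (suc n)
χ₅-second-pairSum 0 = refl
χ₅-second-pairSum 1 = refl
χ₅-second-pairSum 2 = refl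
χ₅-second-pairSum 3 = refl
χ₅-second-pairSum 4 = refl
χ₅-second-pairSum (suc (suc (suc (suc (suc n))))) = χ₅-second-pairSum n

ν₅-second-pairSum : ∀ n → pairSum (pairSum ν₅) n ≡ - χ₅ (suc n)
ν₅-second-pairSum 0 = refl
ν₅-second-pairSum 1 = refl
ν₅-second-pairSum 2 = refl
ν₅-second-pairSum 3 = refl
ν₅-second-pairSum 4 = refl
ν₅-second-pairSum (suc (suc (suc (suc (suc n))))) = ν₅-second-pairSum n

-- This is the n-th power of (1+E)²E⁻¹ applied to `χ₅`; evaluation at j + n makes up for E⁻ⁿ. One
-- more factor turns the coefficients (a, b) into (3a - b, a).
pairSum^-χ₅ : ∀ n j →
  pairSum^ (n ℕ.+ n) χ₅ j ≡ evenFib (suc n) * χ₅ (j ℕ.+ n) + evenFib n * ν₅ (j ℕ.+ n)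
pairSum^-χ₅ zero j = begin
  χ₅ j                           ≡⟨ cong χ₅ (ℕₚ.+-identityʳ j) ⟨
  χ₅ (j ℕ.+ 0)                   ≡⟨ ring (χ₅ (j ℕ.+ 0)) (ν₅ (j ℕ.+ 0)) ⟩
  + 1 * χ₅ (j ℕ.+ 0) + + 0 * ν₅ (j ℕ.+ 0) ∎
  where
  ring : ∀ x y → x ≡ + 1 * x + + 0 * y
  ring = solve-∀
pairSum^-χ₅ (suc n) j = begin
  pairSum^ (suc n ℕ.+ suc n) χ₅ j
    ≡⟨ cong (λ t → pairSum^ t χ₅ j) (cong suc (ℕₚ.+-suc n n)) ⟩
  pairSum^ (suc (suc (n ℕ.+ n))) χ₅ j
    ≡⟨ pairSum^-suc (suc (n ℕ.+ n)) χ₅ j ⟩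
  pairSum^ (suc (n ℕ.+ n)) χ₅ j + pairSum^ (suc (n ℕ.+ n)) χ₅ (suc j)
    ≡⟨ cong₂ _+_ (once j) (once (suc j)) ⟩
  (f₁ * χ₅ i + f₀ * ν₅ i + (f₁ * χ₅ (suc i) + f₀ * ν₅ (suc i)))
    + (f₁ * χ₅ (suc i) + f₀ * ν₅ (suc i) + (f₁ * χ₅ (suc (suc i)) + f₀ * ν₅ (suc (suc i))))
    ≡⟨ step f₀ f₁ (χ₅ i) (χ₅ (suc i)) (χ₅ (suc (suc i))) (ν₅ i) (ν₅ (suc i)) (ν₅ (suc (suc i)))
         (χ₅-second-pairSum i) (ν₅-second-pairSum i) ⟩
  evenFib (suc (suc n)) * χ₅ (suc i) + f₁ * ν₅ (suc i)
    ≡⟨ cong (λ t → evenFib (suc (suc n)) * χ₅ t + f₁ * ν₅ t) (ℕₚ.+-suc j n) ⟨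
  evenFib (suc (suc n)) * χ₅ (j ℕ.+ suc n) + f₁ * ν₅ (j ℕ.+ suc n) ∎
  where
  i = j ℕ.+ n
  f₀ = evenFib n
  f₁ = evenFib (suc n)
  once : ∀ j → pairSum^ (suc (n ℕ.+ n)) χ₅ j ≡
    f₁ * χ₅ (j ℕ.+ n) + f₀ * ν₅ (j ℕ.+ n) + (f₁ * χ₅ (suc j ℕ.+ n) + f₀ * ν₅ (suc j ℕ.+ n))
  once j = trans (pairSum^-suc (n ℕ.+ n) χ₅ j) (cong₂ _+_ (pairSum^-χ₅ n j) (pairSum^-χ₅ n (suc j)))
  ring : ∀ f₀ f₁ x₀ x₁ x₂ y₀ y₁ y₂ →
    (f₁ * x₀ + f₀ * y₀ + (f₁ * x₁ + f₀ * y₁)) + (f₁ * x₁ + f₀ * y₁ + (f₁ * x₂ + f₀ * y₂))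
    ≡ (+ 3 * f₁ - f₀) * x₁ + f₁ * y₁
      + f₁ * ((x₀ + x₁ + (x₁ + x₂)) - (y₁ + + 3 * x₁))
      + f₀ * ((y₀ + y₁ + (y₁ + y₂)) - - x₁)
  ring = solve-∀
  step : ∀ f₀ f₁ x₀ x₁ x₂ y₀ y₁ y₂ →
    x₀ + x₁ + (x₁ + x₂) ≡ y₁ + + 3 * x₁ → y₀ + y₁ + (y₁ + y₂) ≡ - x₁ →
    (f₁ * x₀ + f₀ * y₀ + (f₁ * x₁ + f₀ * y₁)) + (f₁ * x₁ + f₀ * y₁ + (f₁ * x₂ + f₀ * y₂))
    ≡ (+ 3 * f₁ - f₀) * x₁ + f₁ * y₁
  step f₀ f₁ x₀ x₁ x₂ y₀ y₁ y₂ hx hy =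
    by-relation f₁ hx (by-relation f₀ hy (ring f₀ f₁ x₀ x₁ x₂ y₀ y₁ y₂))

-- The exact formula for the partial sums of `signedCentral`.

signedFib : ℕ → ℤ
signedFib d = negOnePow d * evenFib d

-- Only the half of row 2n from its centre on enters; the central term is zero because F_0 = 0.
halfRowTerm : ℕ → ℕ → ℤ
halfRowTerm n d = binom (n ℕ.+ n) (n ℕ.+ d) * signedFib d

halfRowSum : ℕ → ℤ
halfRowSum n = sumTo n (halfRowTerm n)

-- Pascal's rule twice writes an entry of row 2n+2 as x₀ + 2x₁ + x₂ in row 2n, and adding the term
-- of row 2n gives x₀ + 3x₁ + x₂. Since g = `signedFib` satisfies g(d-1) + 3g(d) + g(d+1) = 0,
-- summation by parts leaves only boundary terms, at the centre and at K.
halfRowSum-partial : ∀ n K →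
  sumTo K (halfRowTerm (suc n)) + sumTo K (halfRowTerm n)
  ≡ - binom (n ℕ.+ n) n - signedFib (suc K) * binom (n ℕ.+ n) (n ℕ.+ K)
    + signedFib K * binom (n ℕ.+ n) (n ℕ.+ suc K)
halfRowSum-partial n zero =
  step (binom (suc n ℕ.+ suc n) (suc n ℕ.+ 0)) (binom (n ℕ.+ n) (n ℕ.+ 0)) (binom (n ℕ.+ n) n)
    (binom (n ℕ.+ n) (n ℕ.+ 1)) (cong (binom (n ℕ.+ n)) (ℕₚ.+-identityʳ n))
  where
  step : ∀ a b c d → b ≡ c → a * + 0 + b * + 0 ≡ - c - - + 1 * b + + 0 * d
  step a b _ d refl = ring a b d
    where
    ring : ∀ a b d → a * + 0 + b * + 0 ≡ - b - - + 1 * b + + 0 * d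
    ring = solve-∀
halfRowSum-partial n (suc K) =
  step (sumTo K (halfRowTerm (suc n))) (sumTo K (halfRowTerm n)) (binom (n ℕ.+ n) n)
    (binom (suc n ℕ.+ suc n) (suc n ℕ.+ suc K))
    (binom (n ℕ.+ n) (n ℕ.+ K)) (binom (n ℕ.+ n) (n ℕ.+ suc K)) (binom (n ℕ.+ n) (n ℕ.+ suc (suc K)))
    (negOnePow K) (evenFib K) (evenFib (suc K))
    pascal² (halfRowSum-partial n K)
  where
  N = n ℕ.+ n
  pascal² : binom (suc n ℕ.+ suc n) (suc n ℕ.+ suc K)
    ≡ binom N (n ℕ.+ K) + binom N (n ℕ.+ suc K) + (binom N (n ℕ.+ suc K) + binom N (n ℕ.+ suc (suc K)))
  pascal² = begin
    binom (suc n ℕ.+ suc n) (suc n ℕ.+ suc K)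
      ≡⟨ cong₂ (λ a b → binom (suc a) (suc b)) (ℕₚ.+-suc n n) (ℕₚ.+-suc n K) ⟩
    binom (suc (suc N)) (suc (suc (n ℕ.+ K)))
      ≡⟨ binom-pascal (suc N) (suc (n ℕ.+ K)) ⟩
    binom (suc N) (suc (n ℕ.+ K)) + binom (suc N) (suc (suc (n ℕ.+ K)))
      ≡⟨ cong₂ _+_ (binom-pascal N (n ℕ.+ K)) (binom-pascal N (suc (n ℕ.+ K))) ⟩
    binom N (n ℕ.+ K) + binom N (suc (n ℕ.+ K))
      + (binom N (suc (n ℕ.+ K)) + binom N (suc (suc (n ℕ.+ K))))
      ≡⟨ cong₂ (λ a b → binom N (n ℕ.+ K) + binom N a + (binom N a + binom N b))
           (ℕₚ.+-suc n K) (trans (ℕₚ.+-suc n (suc K)) (cong suc (ℕₚ.+-suc n K))) ⟨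
    binom N (n ℕ.+ K) + binom N (n ℕ.+ suc K)
      + (binom N (n ℕ.+ suc K) + binom N (n ℕ.+ suc (suc K))) ∎
  ring : ∀ S₁ S₂ c x₀ x₁ x₂ s f₀ f₁ →
    S₁ + (x₀ + x₁ + (x₁ + x₂)) * (- s * f₁) + (S₂ + x₁ * (- s * f₁))
    ≡ - c - (- - s * (+ 3 * f₁ - f₀)) * x₁ + (- s * f₁) * x₂
      + + 1 * (S₁ + S₂ - (- c - (- s * f₁) * x₀ + (s * f₀) * x₁))
  ring = solve-∀
  step : ∀ S₁ S₂ c X x₀ x₁ x₂ s f₀ f₁ → X ≡ x₀ + x₁ + (x₁ + x₂) →
    S₁ + S₂ ≡ - c - (- s * f₁) * x₀ + (s * f₀) * x₁ →
    S₁ + X * (- s * f₁) + (S₂ + x₁ * (- s * f₁))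
    ≡ - c - (- - s * (+ 3 * f₁ - f₀)) * x₁ + (- s * f₁) * x₂
  step S₁ S₂ c _ x₀ x₁ x₂ s f₀ f₁ refl h = by-relation (+ 1) h (ring S₁ S₂ c x₀ x₁ x₂ s f₀ f₁)

-- At K = n+1 the boundary entries other than the centre lie beyond the end of row 2n.
halfRowSum-suc : ∀ n → halfRowSum (suc n) + halfRowSum n ≡ - binom (n ℕ.+ n) n
halfRowSum-suc n =
  step (halfRowSum (suc n)) (halfRowSum n) (binom (n ℕ.+ n) n)
    (binom (n ℕ.+ n) (n ℕ.+ suc n)) (binom (n ℕ.+ n) (n ℕ.+ suc (suc n)))
    (signedFib (suc n)) (signedFib (suc (suc n)))
    (binom-> (ℕₚ.+-monoʳ-< n (ℕₚ.n<1+n n)))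
    (binom-> (ℕₚ.+-monoʳ-< n (ℕₚ.m<n⇒m<1+n (ℕₚ.n<1+n n))))
    (halfRowSum-partial n (suc n))
  where
  step : ∀ S₁ S₂ c x₁ x₂ y₁ y₂ → x₁ ≡ + 0 → x₂ ≡ + 0 →
    S₁ + (S₂ + x₁ * y₁) ≡ - c - y₂ * x₁ + y₁ * x₂ → S₁ + S₂ ≡ - c
  step S₁ S₂ c _ _ y₁ y₂ refl refl h = by-relation (+ 1) h (ring S₁ S₂ c y₁ y₂)
    where
    ring : ∀ S₁ S₂ c y₁ y₂ →
      S₁ + S₂ ≡ - c + + 1 * (S₁ + (S₂ + + 0 * y₁) - (- c - y₂ * + 0 + y₁ * + 0))
    ring = solve-∀

-- Multiplied by a sign, `halfRowSum-suc` says that consecutive right-hand sides differ by one value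
-- of `signedCentral`.
sum-signedCentral : ∀ q → sumTo q signedCentral ≡ negOnePow (suc q) * halfRowSum (suc q)
sum-signedCentral zero = refl
sum-signedCentral (suc q) =
  step (sumTo q signedCentral) (binom (2 ℕ.* suc q) (suc q)) (binom (suc q ℕ.+ suc q) (suc q))
    (negOnePow (suc q)) (halfRowSum (suc (suc q))) (halfRowSum (suc q))
    (cong (λ N → binom N (suc q)) (2*n≡n+n (suc q))) (sum-signedCentral q) (halfRowSum-suc (suc q))
  where
  ring : ∀ S b s H₂ H₁ → S + b * s ≡ - s * H₂ + + 1 * (S - s * H₁) + s * (H₂ + H₁ - - b)
  ring = solve-∀
  step : ∀ S a b s H₂ H₁ → a ≡ b → S ≡ s * H₁ → H₂ + H₁ ≡ - b → S + a * s ≡ - s * H₂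
  step S _ b s H₂ H₁ refl hS hH = by-relation (+ 1) hS (by-relation s hH (ring S b s H₂ H₁))

-- Congruences modulo an integer.

module Modular (m : ℤ) where

  infix 4 _≈_

  -- The quotient is kept as data because it supplies the numerator of the final witness.
  record _≈_ (x y : ℤ) : Set where
    constructor congruent
    field
      quotient : ℤ
      equality : x ≡ y + m * quotient

  ≈-reflexive : ∀ {x y} → x ≡ y → x ≈ y
  ≈-reflexive {x} refl = congruent (+ 0) (ring x m)
    where
    ring : ∀ x m → x ≡ x + m * + 0
    ring = solve-∀

  ≈-trans : ∀ {x y z} → x ≈ y → y ≈ z → x ≈ z
  ≈-trans {z = z} (congruent a refl) (congruent b refl) = congruent (b + a) (ring z m a b)
    where
    ring : ∀ z m a b → z + m * b + m * a ≡ z + m * (b + a)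
    ring = solve-∀

  +-cong : ∀ {x y u v} → x ≈ y → u ≈ v → x + u ≈ y + v
  +-cong {y = y} {v = v} (congruent a refl) (congruent b refl) = congruent (a + b) (ring y v m a b)
    where
    ring : ∀ y v m a b → y + m * a + (v + m * b) ≡ y + v + m * (a + b)
    ring = solve-∀

  *-cong : ∀ {x y u v} → x ≈ y → u ≈ v → x * u ≈ y * v
  *-cong {y = y} {v = v} (congruent a refl) (congruent b refl) =
    congruent (y * b + a * v + m * a * b) (ring y v m a b)
    where
    ring : ∀ y v m a b → (y + m * a) * (v + m * b) ≡ y * v + m * (y * b + a * v + m * a * b)
    ring = solve-∀

  *-congˡ : ∀ x {u v} → u ≈ v → x * u ≈ x * v
  *-congˡ x = *-cong {x} {x} (≈-reflexive refl)

  *-congʳ : ∀ {u v} x → u ≈ v → u * x ≈ v * x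
  *-congʳ {u} {v} x u≈v = *-cong {u} {v} {x} {x} u≈v (≈-reflexive refl)

  neg-cong : ∀ {x y} → x ≈ y → - x ≈ - y
  neg-cong {y = y} (congruent a refl) = congruent (- a) (ring y m a)
    where
    ring : ∀ y m a → - (y + m * a) ≡ - y + m * - a
    ring = solve-∀

  sumTo-cong-≈ : ∀ n {f g : ℕ → ℤ} → (∀ k → k ℕ.≤ n → f k ≈ g k) → sumTo n f ≈ sumTo n g
  sumTo-cong-≈ zero    f≈g = f≈g 0 z≤n
  sumTo-cong-≈ (suc n) f≈g =
    +-cong (sumTo-cong-≈ n (λ k k≤n → f≈g k (ℕₚ.m≤n⇒m≤1+n k≤n))) (f≈g (suc n) ℕₚ.≤-refl)

  sumTo-first : ∀ n {f : ℕ → ℤ} → (∀ k → k ℕ.< n → f (suc k) ≈ + 0) → sumTo n f ≈ f 0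
  sumTo-first zero        f≈0 = ≈-reflexive refl
  sumTo-first (suc n) {f} f≈0 =
    ≈-trans (+-cong (sumTo-first n (λ k k<n → f≈0 k (ℕₚ.m<n⇒m<1+n k<n))) (f≈0 n ℕₚ.≤-refl))
      (≈-reflexive (ℤₚ.+-identityʳ (f 0)))

  sumTo-ends : ∀ n {f : ℕ → ℤ} → (∀ k → k ℕ.< n → f (suc k) ≈ + 0) →
    sumTo (suc n) f ≈ f 0 + f (suc n)
  sumTo-ends n f≈0 = +-cong (sumTo-first n f≈0) (≈-reflexive refl)

  -- Meant for `reducedTerm`, whose last term is exceptional because C(p,p) = 1 while the other
  -- C(p,j+1) vanish modulo p.
  sumTo-cong-except-last : ∀ n {f g : ℕ → ℤ} {e} →
    (∀ k → k ℕ.< n → f k ≈ g k) → f n ≈ g n + e → sumTo n f ≈ sumTo n g + e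
  sumTo-cong-except-last zero            f≈g fn≈ = fn≈
  sumTo-cong-except-last (suc n) {g = g} {e} f≈g fn≈ =
    ≈-trans (+-cong (sumTo-cong-≈ n (λ k k≤n → f≈g k (s≤s k≤n))) fn≈)
      (≈-reflexive (sym (ℤₚ.+-assoc (sumTo n g) (g (suc n)) e)))

negOnePow-square : ∀ n → negOnePow n * negOnePow n ≡ + 1
negOnePow-square zero    = refl
negOnePow-square (suc n) = trans (ring (negOnePow n)) (negOnePow-square n)
  where
  ring : ∀ s → - s * - s ≡ s * s
  ring = solve-∀

negOnePow-odd : ∀ h → negOnePow (suc (h ℕ.* 2)) ≡ - + 1
negOnePow-odd zero    = refl
negOnePow-odd (suc h) = trans (ℤₚ.neg-involutive _) (negOnePow-odd h)

-- Binomial and Fibonacci congruences modulo a prime p = q + 1.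

module PrimeModulus (q : ℕ) (p-prime : Prime (suc q)) where

  open Modular (+ suc q)

  p : ℕ
  p = suc q

  ∣⇒≈0 : ∀ {n} → p ∣ n → + n ≈ + 0
  ∣⇒≈0 (divides a refl) = congruent (+ a)
    (trans (ℤₚ.pos-* a p) (trans (ℤₚ.*-comm (+ a) (+ p)) (sym (ℤₚ.+-identityˡ _))))

  -- By absorption p divides (k+1) C(p,k+1), and p cannot divide k+1 < p.
  p∣pC1+k : ∀ k → k ℕ.< q → p ∣ (p C suc k)
  p∣pC1+k k k<q with euclidsLemma (suc k) (p C suc k) p-prime
    (divides (q C k) (ℤₚ.+-injective (begin
      + (suc k ℕ.* (p C suc k))      ≡⟨ ℤₚ.pos-* (suc k) (p C suc k) ⟩
      + suc k * binom p (suc k)      ≡⟨ binom-absorption q k ⟩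
      + p * binom q k                ≡⟨ ℤₚ.*-comm (+ p) (binom q k) ⟩
      binom q k * + p                ≡⟨ ℤₚ.pos-* (q C k) p ⟨
      + ((q C k) ℕ.* p)              ∎)))
  ... | inj₁ p∣1+k = contradiction (∣⇒≤ p∣1+k) (ℕₚ.<⇒≱ (s≤s k<q))
  ... | inj₂ p∣C   = p∣C

  binom-p : ∀ k → k ℕ.< q → binom p (suc k) ≈ + 0
  binom-p k k<q = ∣⇒≈0 (p∣pC1+k k k<q)

  pairSum^-p : ∀ f j → pairSum^ p f j ≈ f j + f (j ℕ.+ p)
  pairSum^-p f j = ≈-trans (≈-reflexive (pairSum^-binomial p f j))
    (≈-trans (sumTo-ends q (λ k k<q → ≈-trans (*-congʳ (f (j ℕ.+ suc k)) (binom-p k k<q))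
        (≈-reflexive (ℤₚ.*-zeroˡ (f (j ℕ.+ suc k))))))
      (≈-reflexive (cong₂ _+_
        (trans (ℤₚ.*-identityˡ _) (cong f (ℕₚ.+-identityʳ j)))
        (trans (cong (λ t → + t * f (j ℕ.+ p)) (nCn≡1 p)) (ℤₚ.*-identityˡ _)))))

  -- Row 2p from its centre on is (1+E)^p applied to row p, and (1+E)^p ≡ 1 + E^p.
  binom-2p : ∀ d → binom (p ℕ.+ p) (p ℕ.+ d) ≈ binom p d + binom p (d ℕ.+ p)
  binom-2p d = ≈-trans (≈-reflexive (sym (pairSum^-binom p p d))) (pairSum^-p (binom p) d)

  binom-2p-suc : ∀ d → d ℕ.< q → binom (p ℕ.+ p) (p ℕ.+ suc d) ≈ + 0
  binom-2p-suc d d<q = ≈-trans (binom-2p (suc d))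
    (+-cong (binom-p d d<q) (≈-reflexive (binom-> {p} {suc d ℕ.+ p} (ℕₚ.m<n+m p (s≤s z≤n)))))

  binom-2p-p : binom (2 ℕ.* p) p ≈ + 2
  binom-2p-p = ≈-trans
    (≈-reflexive (cong₂ binom (2*n≡n+n p) (sym (ℕₚ.+-identityʳ p))))
    (≈-trans (binom-2p 0) (≈-reflexive (cong (λ t → + 1 + + t) (nCn≡1 p))))

  halfRowSum-p : halfRowSum p ≈ signedFib p
  halfRowSum-p = ≈-trans
    (sumTo-ends q (λ k k<q → ≈-trans (*-congʳ (signedFib (suc k)) (binom-2p-suc k k<q))
      (≈-reflexive (ℤₚ.*-zeroˡ (signedFib (suc k))))))
    (≈-reflexive (begin
      binom (p ℕ.+ p) (p ℕ.+ 0) * + 0 + binom (p ℕ.+ p) (p ℕ.+ p) * signedFib p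
        ≡⟨ cong₂ (λ s t → s + + t * signedFib p) (ℤₚ.*-zeroʳ (binom (p ℕ.+ p) (p ℕ.+ 0))) (nCn≡1 (p ℕ.+ p)) ⟩
      + 0 + + 1 * signedFib p  ≡⟨ ℤₚ.+-identityˡ _ ⟩
      + 1 * signedFib p        ≡⟨ ℤₚ.*-identityˡ _ ⟩
      signedFib p              ∎))

  -- (1+E)^(2p) `χ₅` is evaluated at one point twice: exactly by `pairSum^-χ₅`, and modulo p as
  -- (1+E^p)² `χ₅`.
  2*evenFib-p : + 2 * evenFib p ≈ + 2 * χ₅ p
  2*evenFib-p = ≈-trans (≈-reflexive (sym exact)) (≈-trans frobenius (≈-reflexive collapse))
    where
    -- With j = 4p the middle point j + p = 5p has `χ₅` = 0 and `ν₅` = 2, which isolates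
    -- `evenFib p`; the outer points 4p and 6p both have the symbol of p.
    j = p ℕ.* 4
    j+p : j ℕ.+ p ≡ p ℕ.* 5
    j+p = trans (ℕₚ.+-comm j p) (sym (ℕₚ.*-suc p 4))
    χ-j+p : χ₅ (j ℕ.+ p) ≡ + 0
    χ-j+p = trans (cong χ₅ (trans j+p (sym (ℕₚ.+-identityʳ (p ℕ.* 5))))) (χ₅-*5+ p 0)
    exact : pairSum^ (p ℕ.+ p) χ₅ j ≡ + 2 * evenFib p
    exact = begin
      pairSum^ (p ℕ.+ p) χ₅ j
        ≡⟨ pairSum^-χ₅ p j ⟩
      evenFib (suc p) * χ₅ (j ℕ.+ p) + evenFib p * ν₅ (j ℕ.+ p)
        ≡⟨ cong₂ (λ s t → evenFib (suc p) * s + evenFib p * t) χ-j+p (trans (cong ν₅ j+p) (ν₅-*5 p)) ⟩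
      evenFib (suc p) * + 0 + evenFib p * + 2
        ≡⟨ ring (evenFib (suc p)) (evenFib p) ⟩
      + 2 * evenFib p ∎
      where
      ring : ∀ a b → a * + 0 + b * + 2 ≡ + 2 * b
      ring = solve-∀
    frobenius : pairSum^ (p ℕ.+ p) χ₅ j ≈ χ₅ j + χ₅ (j ℕ.+ p) + (χ₅ (j ℕ.+ p) + χ₅ (j ℕ.+ p ℕ.+ p))
    frobenius = ≈-trans (≈-reflexive (cong (λ f → f j) (pairSum^-+ p p χ₅)))
      (≈-trans (pairSum^-p (pairSum^ p χ₅) j)
        (+-cong (pairSum^-p χ₅ j) (pairSum^-p χ₅ (j ℕ.+ p))))
    collapse : χ₅ j + χ₅ (j ℕ.+ p) + (χ₅ (j ℕ.+ p) + χ₅ (j ℕ.+ p ℕ.+ p)) ≡ + 2 * χ₅ p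
    collapse = begin
      χ₅ j + χ₅ (j ℕ.+ p) + (χ₅ (j ℕ.+ p) + χ₅ (j ℕ.+ p ℕ.+ p))
        ≡⟨ cong₂ (λ s t → χ₅ j + s + (s + t)) χ-j+p
             (trans (cong (λ t → χ₅ (t ℕ.+ p)) j+p) (χ₅-*5+ p p)) ⟩
      χ₅ j + + 0 + (+ 0 + χ₅ p)
        ≡⟨ cong (λ t → t + + 0 + (+ 0 + χ₅ p)) (χ₅-*4 p) ⟩
      χ₅ p + + 0 + (+ 0 + χ₅ p)
        ≡⟨ ring (χ₅ p) ⟩
      + 2 * χ₅ p ∎
      where
      ring : ∀ a → a + + 0 + (+ 0 + a) ≡ + 2 * a
      ring = solve-∀

-- The congruence modulo p³ for odd p = 2h + 1.

module OddPrimeModulus (h : ℕ) (p-prime : Prime (suc (h ℕ.* 2))) where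

  q : ℕ
  q = h ℕ.* 2

  open Modular (+ suc q)
  open PrimeModulus q p-prime

  2*-cancel : ∀ {x y} → + 2 * x ≈ + 2 * y → x ≈ y
  -- Since 1 = p - 2h, x - y = p(x - y) - h · 2(x - y), where 2(x - y) = p a.
  2*-cancel {x} {y} (congruent a 2x≡2y+pa) = congruent (x - y - + h * a)
    (step x y (+ h) (+ p) a (cong (λ t → + 1 + t) (ℤₚ.pos-* h 2)) 2x≡2y+pa)
    where
    step : ∀ x y h p a → p ≡ + 1 + h * + 2 → + 2 * x ≡ + 2 * y + p * a →
      x ≡ y + p * (x - y - h * a)
    step x y h _ a refl eq = by-relation (- h) eq (ring x y h a)
      where
      ring : ∀ x y h a → let p = + 1 + h * + 2 in
        x ≡ y + p * (x - y - h * a) + - h * (+ 2 * x - (+ 2 * y + p * a))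
      ring = solve-∀

  evenFib-p : evenFib p ≈ χ₅ p
  evenFib-p = 2*-cancel 2*evenFib-p

  sum-signedCentral-p : sumTo q signedCentral ≈ χ₅ p
  sum-signedCentral-p = ≈-trans (≈-reflexive (sum-signedCentral q))
    (≈-trans (*-congˡ (negOnePow p) {halfRowSum p} {signedFib p} halfRowSum-p)
    (≈-trans (≈-reflexive (begin
      negOnePow p * (negOnePow p * evenFib p)  ≡⟨ ℤₚ.*-assoc (negOnePow p) (negOnePow p) (evenFib p) ⟨
      negOnePow p * negOnePow p * evenFib p    ≡⟨ cong (_* evenFib p) (negOnePow-square p) ⟩
      + 1 * evenFib p                          ≡⟨ ℤₚ.*-identityˡ (evenFib p) ⟩
      evenFib p                                ∎))
    evenFib-p))

  signedCentral-p : signedCentral p ≈ - + 2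
  signedCentral-p = *-cong {binom (2 ℕ.* p) p} {+ 2} {negOnePow p} { - + 1}
    binom-2p-p (≈-reflexive (negOnePow-odd h))

  -- C(p-1,k+1) = C(p,k+1) - C(p-1,k) with C(p,k+1) ≡ 0, so each step flips the sign.
  binom-p-1 : ∀ k → k ℕ.≤ q → binom q k ≈ negOnePow k
  binom-p-1 zero    _   = ≈-reflexive refl
  binom-p-1 (suc k) k<q = ≈-trans
    (≈-reflexive (step (binom q k) (binom q (suc k)) (binom p (suc k)) (binom-pascal q k)))
    (≈-trans (+-cong (binom-p k k<q) (neg-cong (binom-p-1 k (ℕₚ.<⇒≤ k<q))))
      (≈-reflexive (ℤₚ.+-identityˡ _)))
    where
    ring : ∀ a b → b ≡ a + b + - a
    ring = solve-∀
    step : ∀ a b c → c ≡ a + b → b ≡ c + - a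
    step a b _ refl = ring a b

  binom-p-1-square : ∀ k → k ℕ.≤ q → binom q k * binom q k ≈ + 1
  binom-p-1-square k k≤q = ≈-trans (*-cong (binom-p-1 k k≤q) (binom-p-1 k k≤q))
    (≈-reflexive (negOnePow-square k))

  reducedTerm-< : ∀ j → j ℕ.< q → reducedTerm q j ≈ - + 3 * signedCentral (suc j)
  reducedTerm-< j j<q = step (binom q j) (binom p (suc j)) (binom q j * binom q j)
    (signedCentral (suc j)) (binom-p j j<q) (binom-p-1-square j (ℕₚ.<⇒≤ j<q))
    where
    ring : ∀ b c → (+ 2 * (b * + 0) + - (+ 3 * + 1)) * c ≡ - + 3 * c
    ring = solve-∀
    step : ∀ b d e c → d ≈ + 0 → e ≈ + 1 → (+ 2 * (b * d) - + 3 * e) * c ≈ - + 3 * c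
    step b d e c d≈0 e≈1 = ≈-trans
      (*-congʳ {+ 2 * (b * d) - + 3 * e} {+ 2 * (b * + 0) + - (+ 3 * + 1)} c
        (+-cong (*-congˡ (+ 2) {b * d} {b * + 0} (*-congˡ b d≈0))
          (neg-cong (*-congˡ (+ 3) {e} {+ 1} e≈1))))
      (≈-reflexive (ring b c))

  -- Both binomials are 1 here. The value -c is split into the generic -3c and the correction 2c.
  reducedTerm-last : reducedTerm q q ≡ - + 3 * signedCentral p + + 2 * signedCentral p
  reducedTerm-last = trans
    (cong₂ (λ a b → (+ 2 * (+ a * + b) - + 3 * (+ a * + a)) * signedCentral p) (nCn≡1 q) (nCn≡1 p))
    (ring (signedCentral p))
    where
    ring : ∀ c → - + 1 * c ≡ - + 3 * c + + 2 * c
    ring = solve-∀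

  sum-reducedTerm : sumTo q (reducedTerm q) ≈ + 5 - + 3 * χ₅ p
  sum-reducedTerm = ≈-trans
    (sumTo-cong-except-last q {reducedTerm q} {λ j → - + 3 * signedCentral (suc j)}
      {+ 2 * signedCentral p} reducedTerm-< (≈-reflexive reducedTerm-last))
    (≈-trans (≈-reflexive (cong (_+ + 2 * signedCentral p)
        (sumTo-*ˡ q (- + 3) (λ j → signedCentral (suc j)))))
      (step (sumTo q (λ j → signedCentral (suc j))) (sumTo q signedCentral) (signedCentral p) (χ₅ p)
        (sumTo-head q signedCentral) sum-signedCentral-p signedCentral-p))
    where
    -- A sums `signedCentral` over 1..p and S over 0..p-1, so A = S + c - 1 with c the value at p,
    -- and -3A + 2c = 3 - 3S - c.
    ring : ∀ A S c → - + 3 * A + + 2 * c ≡ + 3 + - + 3 * S + - c + + 3 * (S + c - (+ 1 + A))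
    ring = solve-∀
    ring′ : ∀ x → + 3 + - + 3 * x + - - + 2 ≡ + 5 - + 3 * x
    ring′ = solve-∀
    step : ∀ A S c x → S + c ≡ + 1 + A → S ≈ x → c ≈ - + 2 →
      - + 3 * A + + 2 * c ≈ + 5 - + 3 * x
    step A S c x eq S≈x c≈-2 = ≈-trans
      (≈-reflexive (by-relation (+ 3) eq (ring A S c)))
      (≈-trans
        (+-cong {+ 3 + - + 3 * S} {+ 3 + - + 3 * x} { - c} { - - + 2}
          (+-cong {+ 3} {+ 3} (≈-reflexive refl) (*-congˡ (- + 3) {S} {x} S≈x))
          (neg-cong c≈-2))
        (≈-reflexive (ring′ x)))

  -- The factor p² is exact, so a congruence modulo p for the cofactor gives one modulo p³.
  2*sumT2-mod-p³ : ∃ λ t →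
    + 2 * sumT2 p ≡ + (p ℕ.^ 2) * (+ 5 - + 3 * legendre5 p) + + (p ℕ.^ 3) * t
  2*sumT2-mod-p³ = quotient sum-reducedTerm ,
    step (+ p) (+ (p ℕ.^ 2)) (+ (p ℕ.^ 3)) (χ₅ p) (legendre5 p) (quotient sum-reducedTerm)
      (+ 2 * sumTo q T2) (sumTo q (reducedTerm q))
      (2*sumT2-factor q) (equality sum-reducedTerm) (χ₅≡legendre5 p) (pos-^2 p)
      (trans (ℤₚ.pos-* p (p ℕ.^ 2)) (cong (+ p *_) (pos-^2 p)))
    where
    open _≈_
    ring : ∀ P x t → P * P * (+ 5 - + 3 * x + P * t) ≡ P * P * (+ 5 - + 3 * x) + P * (P * P) * t
    ring = solve-∀
    step : ∀ P P² P³ x y t S R → S ≡ P * P * R → R ≡ + 5 - + 3 * x + P * t → x ≡ y →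
      P² ≡ P * P → P³ ≡ P * (P * P) → S ≡ P² * (+ 5 - + 3 * y) + P³ * t
    step P _ _ x _ t _ _ refl refl refl refl refl = ring P x t

-- Passage to rationals and the split into p = 2 and odd p.

-- Computed with unnormalised fractions, where no gcd intervenes and equality is
-- cross-multiplication.
clear-denominators : ∀ S N M t → + 2 * S ≡ N + M * t →
  (S / 1 ℚ.- N / 2) ℚ.* (+ 2 / 1) ≡ (M / 1) ℚ.* (t / 1)
clear-denominators S N M t eq = ℚₚ.toℚᵘ-injective (begin-≃
  toℚᵘ ((S / 1 ℚ.- N / 2) ℚ.* (+ 2 / 1))
    ≈⟨ ℚₚ.toℚᵘ-homo-* (S / 1 ℚ.- N / 2) (+ 2 / 1) ⟩
  toℚᵘ (S / 1 ℚ.- N / 2) ℚᵘ.* toℚᵘ (+ 2 / 1)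
    ≈⟨ ℚᵘₚ.*-congʳ {toℚᵘ (+ 2 / 1)} (ℚₚ.toℚᵘ-homo-+ (S / 1) (ℚ.- (N / 2))) ⟩
  (toℚᵘ (S / 1) ℚᵘ.+ toℚᵘ (ℚ.- (N / 2))) ℚᵘ.* toℚᵘ (+ 2 / 1)
    ≈⟨ ℚᵘₚ.*-cong (ℚᵘₚ.+-cong (ℚₚ.toℚᵘ-fromℚᵘ (mkℚᵘ S 0))
         (ℚᵘₚ.≃-trans (ℚₚ.toℚᵘ-homo‿- (N / 2)) (ℚᵘₚ.-‿cong (ℚₚ.toℚᵘ-fromℚᵘ (mkℚᵘ N 1)))))
         (ℚₚ.toℚᵘ-fromℚᵘ (mkℚᵘ (+ 2) 0)) ⟩
  (mkℚᵘ S 0 ℚᵘ.- mkℚᵘ N 1) ℚᵘ.* mkℚᵘ (+ 2) 0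
    ≈⟨ *≡* (by-relation (+ 2) eq (ring S N M t)) ⟩
  mkℚᵘ M 0 ℚᵘ.* mkℚᵘ t 0
    ≈⟨ ℚᵘₚ.*-cong (ℚₚ.toℚᵘ-fromℚᵘ (mkℚᵘ M 0)) (ℚₚ.toℚᵘ-fromℚᵘ (mkℚᵘ t 0)) ⟨
  toℚᵘ (M / 1) ℚᵘ.* toℚᵘ (t / 1)
    ≈⟨ ℚₚ.toℚᵘ-homo-* (M / 1) (t / 1) ⟨
  toℚᵘ ((M / 1) ℚ.* (t / 1)) ∎-≃)
  where
  open import Relation.Binary.Reasoning.Setoid ℚᵘₚ.≃-setoid
    using (step-≈-⟩; step-≈-⟨) renaming (begin_ to begin-≃_; _∎ to _∎-≃)
  ring : ∀ S N M t → (S * + 2 + - N * + 1) * + 2 * + 1 ≡ M * t * + 2 + + 2 * (+ 2 * S - (N + M * t))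
  ring = solve-∀

even-or-odd : ∀ n → (∃ λ h → n ≡ h ℕ.* 2) ⊎ (∃ λ h → n ≡ suc (h ℕ.* 2))
even-or-odd zero = inj₁ (0 , refl)
even-or-odd (suc n) with even-or-odd n
... | inj₁ (h , refl) = inj₂ (h , refl)
... | inj₂ (h , refl) = inj₁ (suc h , refl)

HoldsFor : ℕ → Set
HoldsFor p = CongModPPow p 3 (sumT2 p / 1)
  ((+ (p ℕ.^ 2) * (+ 5 - + 3 * legendre5 p)) / 2)

holdsFor-2 : HoldsFor 2
-- The sum is 1 - 17 = -16 and the right-hand side is 16; the difference is -32 = 2³ · (-4).
holdsFor-2 = - + 4 , 1 , (λ 2∣1 → contradiction (∣⇒≤ 2∣1) (ℕₚ.<⇒≱ (s≤s (s≤s z≤n)))) , refl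

holdsFor-odd : ∀ h → Prime (suc (suc h ℕ.* 2)) → HoldsFor (suc (suc h ℕ.* 2))
-- The denominator is 2, prime to p because p ≥ 3.
holdsFor-odd h p-prime = proj₁ witness , 2
  , (λ p∣2 → contradiction (∣⇒≤ p∣2) (ℕₚ.<⇒≱ (s≤s (s≤s (s≤s z≤n)))))
  , clear-denominators (sumT2 p) (+ (p ℕ.^ 2) * (+ 5 - + 3 * legendre5 p)) (+ (p ℕ.^ 3))
      (proj₁ witness) (proj₂ witness)
  where
  p : ℕ
  p = suc (suc h ℕ.* 2)
  witness = OddPrimeModulus.2*sumT2-mod-p³ (suc h) p-prime

holdsFor-even : ∀ p → Prime p → 2 ∣ p → HoldsFor p
holdsFor-even p p-prime 2∣p with prime⇒irreducible p-prime 2∣p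
... | inj₂ refl = holdsFor-2

holdsFor-prime : ∀ p → (∃ λ h → p ≡ h ℕ.* 2) ⊎ (∃ λ h → p ≡ suc (h ℕ.* 2)) → Prime p → HoldsFor p
holdsFor-prime p (inj₁ (h , p≡h*2))   p-prime = holdsFor-even p p-prime (divides h p≡h*2)
holdsFor-prime _ (inj₂ (zero , refl))  p-prime = contradiction p-prime ¬prime[1]
holdsFor-prime _ (inj₂ (suc h , refl)) p-prime = holdsFor-odd h p-prime

theorem1p3 : (p : ℕ) → Prime p →
    CongModPPow p 3 (sumT2 p / 1)
    ((+ (p ℕ.^ 2) ℤ.* (+ 5 ℤ.- + 3 ℤ.* legendre5 p)) / 2)
theorem1p3 p = holdsFor-prime p (even-or-odd p)
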